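{- For any integers $m\geq k\geq 2$ and any $\alpha\in(0,1)$ there exists a constant $\beta=\beta(\alpha,k,m)>0$ with the following property: if $H$ is a $k$-uniform hypergraph on $n$ vertices with $c_m(H)\geq \alpha\binom{n}{m}$, and $H$ does not contain a complete $m$-tuple of missing edges, then $\omega(H)\geq \beta n$.
   Context: A $k$-uniform hypergraph $H=(V,E)$ consists of a finite vertex set $V$ and an edge set $E\subset\binom{V}{k}$, where $\binom{S}{k}$ denotes the set of $k$-element subsets of $S$. A set $S\subset V$ is a clique if $\binom{S}{k}\subset E$; $\omega(H)$ is the maximum number of vertices of a clique in $H$, and $c_m(H)$ is the number of cliques in $H$ with exactly $m$ vertices. The set of missing edges is $M=\binom{V}{k}\setminus E$. For an integer $m\geq k$, a family $\{\tau_1,\dots,\tau_m\}\subset M$ is a complete $m$-tuple of missing edges if (1) $\tau_i\cap\tau_j=\emptyset$ for all $i\neq j$, and (2) $\{t_1,\dots,t_m\}$ is a clique in $H$ for every choice of $t_i\in\tau_i$, $i\in[m]$. For real $x$, $\binom{x}{k}=\frac{x(x-1)\cdots(x-k+1)}{k!}$ if $x\geq k-1$ and $0$ otherwise. -}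

module Defs where

open import Data.Nat using (ℕ; zero; suc; _≡ᵇ_)
open import Data.Bool using (Bool; true; false; not; _∨_; _∧_; T?)
open import Data.Fin using (Fin)
open import Data.Fin.Subset using (Subset; ∣_∣; _∈_; _∩_; ⊥)
open import Data.Vec using (Vec; []; _∷_; tabulate)
open import Data.List using (List; []; _∷_; _++_; map; filter; length)
open import Data.Fin.Properties using (_≟_; any?)
open import Relation.Nullary.Decidable using (⌊_⌋)
open import Relation.Binary.PropositionalEquality using (_≡_)
open import Relation.Nullary using (¬_)
open import Data.Product using (Σ; _×_)
open import Data.Integer using (+_)
open import Data.Rational using (ℚ; _/_)

toℚ : ℕ → ℚ
toℚ n = + n / 1

record Hypergraph (k n : ℕ) : Set where
  field
    edge    : Subset n → Bool
    uniform : ∀ S → edge S ≡ true → ∣ S ∣ ≡ k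
open Hypergraph public

allSubsets : (n : ℕ) → List (Subset n)
allSubsets zero    = [] ∷ []
allSubsets (suc n) = map (false ∷_) (allSubsets n) ++ map (true ∷_) (allSubsets n)

allᵇ : {A : Set} → (A → Bool) → List A → Bool
allᵇ p []       = true
allᵇ p (x ∷ xs) = p x ∧ allᵇ p xs

_⊆ᵇ_ : ∀ {n} → Subset n → Subset n → Bool
[]      ⊆ᵇ []      = true
(a ∷ s) ⊆ᵇ (b ∷ t) = (not a ∨ b) ∧ (s ⊆ᵇ t)

isCliqueᵇ : ∀ {k n} → Hypergraph k n → Subset n → Bool
isCliqueᵇ {k} {n} H S =
  allᵇ (λ T → not ((T ⊆ᵇ S) ∧ (∣ T ∣ ≡ᵇ k)) ∨ edge H T) (allSubsets n)

IsClique : ∀ {k n} → Hypergraph k n → Subset n → Set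
IsClique H S = isCliqueᵇ H S ≡ true

cliqueCount : ∀ {k n} → ℕ → Hypergraph k n → ℕ
cliqueCount {k} {n} m H =
  length (filter (λ S → T? (isCliqueᵇ H S ∧ (∣ S ∣ ≡ᵇ m))) (allSubsets n))

IsMissingEdge : ∀ {k n} → Hypergraph k n → Subset n → Set
IsMissingEdge {k} H S = (∣ S ∣ ≡ k) × (edge H S ≡ false)

image : ∀ {m n} → (Fin m → Fin n) → Subset n
image {m} t = tabulate (λ v → ⌊ any? (λ i → t i ≟ v) ⌋)

IsCompleteTuple : ∀ {k n} (m : ℕ) → Hypergraph k n → (Fin m → Subset n) → Set
IsCompleteTuple {k} {n} m H τ =
  (∀ i → IsMissingEdge H (τ i)) ×
  (∀ i j → ¬ (i ≡ j) → τ i ∩ τ j ≡ ⊥) ×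
  (∀ (t : Fin m → Fin n) → (∀ i → t i ∈ τ i) → IsClique H (image t))

HasCompleteTuple : ∀ {k n} (m : ℕ) → Hypergraph k n → Set
HasCompleteTuple m H = Σ _ (IsCompleteTuple m H)

{-# OPTIONS --safe #-}
module Submission where

-- Suppose H has no clique on βn vertices. In any vertex set W of linear size one can greedily
-- pick linearly many disjoint missing edges; distribute them into m classes of s edges each.
-- If H has no complete m-tuple, each of the s^m selections of one edge per class has a
-- transversal that is not a clique, so a positive fraction of the m-tuples of W fail to be cliques.
-- Start now from the α n^m cliques (v₁,…,v_m) and replace one coordinate at a time: many
-- (v₂,…,v_m) extend by linearly many v₁, hence by the vertices of a positive fraction of all
-- m-tuples that are not cliques; by double counting some non-clique U₁ works for a positive
-- fraction of the (v₂,…,v_m). After m steps U₁,…,U_m are non-cliques all of whose transversals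
-- are cliques, and a missing edge inside each U_i yields a complete m-tuple.

open import Defs
open import Data.Bool using (Bool; true; false; _∧_; T; T?)
import Data.Bool.Properties as Bool
open import Data.Empty using (⊥-elim)
open import Data.Fin using (Fin; zero; suc; combine)
open import Data.Fin.Properties using (_≟_; any?; all?; combine-injective; suc-injective)
open import Data.Fin.Subset using (Subset; ∣_∣; _∈_; _∉_; _⊆_; _∩_; _─_; ⊥; ⁅_⁆)
import Data.Fin.Subset.Properties as Sub
import Data.Integer as ℤ
import Data.Integer.Properties as ℤ
open import Data.List using (List; []; _∷_; _++_; map; filter; length; allFin; cartesianProductWith)
import Data.List as List
import Data.List.Properties as List
open import Data.List.Membership.Propositional using (find; lose) renaming (_∈_ to _∈ˡ_)
import Data.List.Membership.Propositional.Properties as Mem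
open import Data.List.Relation.Unary.All using ([]; _∷_) renaming (lookup to All-lookup)
open import Data.List.Relation.Unary.AllPairs using ([]; _∷_)
open import Data.List.Relation.Unary.Any as Any using (here; there)
open import Data.List.Relation.Unary.Unique.Propositional using (Unique)
import Data.List.Relation.Unary.Unique.Propositional.Properties as Uniq
open import Data.Nat using (ℕ; zero; suc; _≤_)
open import Data.Nat.Combinatorics using (_C_; nCk+nC[k+1]≡[n+1]C[k+1]; nC1≡n; k>n⇒nCk≡0)
open import Data.Product using (Σ; _×_; _,_; proj₁; proj₂; ∃-syntax)
open import Data.Rational as ℚ using (ℚ; 0ℚ; 1ℚ; mkℚ; toℚᵘ; *<*)
import Data.Rational.Properties as ℚ
import Data.Rational.Unnormalised as ℚᵘ
import Data.Rational.Unnormalised.Properties as ℚᵘ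
open import Data.Sum using (_⊎_; inj₁; inj₂)
open import Data.Unit using (tt)
open import Data.Vec using (Vec; []; _∷_; lookup; tabulate; here; there)
import Data.Vec as Vec
import Data.Vec.Properties as Vec
open import Function using (_∘_; id; case_of_)
open import Relation.Binary.PropositionalEquality
open import Relation.Nullary using (¬_; Dec; yes; no; contradiction; _×-dec_; _→-dec_)
open import Relation.Nullary.Decidable using (⌊_⌋)

module Blowup where

  open import Data.Nat using (_+_; _*_; _^_; _<_; _≤?_; z≤n; s≤s; NonZero; >-nonZero; >-nonZero⁻¹; ≢-nonZero⁻¹; _≡ᵇ_)
  open import Data.Nat.DivMod using (_/_; m/n*n≤m; m≡m%n+[m/n]*n; m%n≤n; m≥n⇒m/n>0)
  open import Data.Nat.ListAction using (sum)
  open import Data.Nat.ListAction.Properties using (sum-++)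
  open import Data.Nat.Properties hiding (_≟_; suc-injective)
  open import Data.Nat.Tactic.RingSolver using (solve-∀)

  private variable
    A B E : Set
    k n M : ℕ

  -- Finite sums, counting and comparison of lengths of lists.

  indicator : Bool → ℕ
  indicator true  = 1
  indicator false = 0

  Σ[_]_ : List A → (A → ℕ) → ℕ
  Σ[ xs ] f = sum (map f xs)

  count : (A → Bool) → List A → ℕ
  count p xs = Σ[ xs ] (indicator ∘ p)

  Σ-mono : ∀ (xs : List A) {f g} → (∀ x → f x ≤ g x) → Σ[ xs ] f ≤ Σ[ xs ] g
  Σ-mono []       f≤g = z≤n
  Σ-mono (x ∷ xs) f≤g = +-mono-≤ (f≤g x) (Σ-mono xs f≤g)

  Σ-+ : ∀ (xs : List A) f g → Σ[ xs ] (λ x → f x + g x) ≡ Σ[ xs ] f + Σ[ xs ] g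
  Σ-+ []       f g = refl
  Σ-+ (x ∷ xs) f g = trans (cong (f x + g x +_) (Σ-+ xs f g)) (interchange (f x) (g x) _ _)
    where
    interchange : ∀ a b c d → a + b + (c + d) ≡ a + c + (b + d)
    interchange = solve-∀

  Σ-*ˡ : ∀ c (xs : List A) f → Σ[ xs ] (λ x → c * f x) ≡ c * Σ[ xs ] f
  Σ-*ˡ c []       f = sym (*-zeroʳ c)
  Σ-*ˡ c (x ∷ xs) f = trans (cong (c * f x +_) (Σ-*ˡ c xs f)) (sym (*-distribˡ-+ c (f x) _))

  Σ-const : ∀ c (xs : List A) → Σ[ xs ] (λ _ → c) ≡ c * length xs
  Σ-const c []       = sym (*-zeroʳ c)
  Σ-const c (x ∷ xs) = trans (cong (c +_) (Σ-const c xs)) (sym (*-suc c (length xs)))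

  Σ-swap : ∀ (xs : List A) (ys : List B) (f : A → B → ℕ) →
           Σ[ xs ] (λ x → Σ[ ys ] f x) ≡ Σ[ ys ] (λ y → Σ[ xs ] (λ x → f x y))
  Σ-swap []       ys f = sym (Σ-const 0 ys)
  Σ-swap (x ∷ xs) ys f = trans (cong (Σ[ ys ] f x +_) (Σ-swap xs ys f)) (sym (Σ-+ ys (f x) _))

  Σ-cartesianProductWith : ∀ (g : A → B → E) xs ys f →
    Σ[ cartesianProductWith g xs ys ] f ≡ Σ[ xs ] (λ x → Σ[ ys ] (f ∘ g x))
  Σ-cartesianProductWith g []       ys f = refl
  Σ-cartesianProductWith g (x ∷ xs) ys f = begin
    sum (map f (map (g x) ys ++ cartesianProductWith g xs ys))       ≡⟨ cong sum (List.map-++ f (map (g x) ys) _) ⟩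
    sum (map f (map (g x) ys) ++ map f (cartesianProductWith g xs ys)) ≡⟨ sum-++ (map f (map (g x) ys)) _ ⟩
    sum (map f (map (g x) ys)) + Σ[ cartesianProductWith g xs ys ] f
      ≡⟨ cong₂ _+_ (cong sum (sym (List.map-∘ ys))) (Σ-cartesianProductWith g xs ys f) ⟩
    Σ[ ys ] (f ∘ g x) + Σ[ xs ] (λ x → Σ[ ys ] (f ∘ g x))            ∎
    where open ≡-Reasoning

  length-filter-T? : ∀ (p : A → Bool) xs → length (filter (T? ∘ p) xs) ≡ count p xs
  length-filter-T? p []       = refl
  length-filter-T? p (x ∷ xs) with p x
  ... | true  = cong suc (length-filter-T? p xs)
  ... | false = length-filter-T? p xs

  -- If every `q * f x` were at most `c - 1`, the sum would be at most `N * (c - 1)`. All densities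
  -- are kept as natural numbers: `q` is the cleared denominator, and `N` only bounds the length
  -- from above.
  pigeonhole : ∀ N q c (xs : List A) f → length xs ≤ N → 0 < N → 0 < c →
               N * c ≤ q * Σ[ xs ] f → ∃[ x ] x ∈ˡ xs × c ≤ q * f x
  pigeonhole {A} N q (suc c) xs f len N>0 _ big with search xs
    where
    search : ∀ (ys : List A) → (∃[ x ] x ∈ˡ ys × suc c ≤ q * f x) ⊎ q * Σ[ ys ] f ≤ length ys * c
    search []       = inj₂ (≤-reflexive (*-zeroʳ q))
    search (y ∷ ys) with suc c ≤? q * f y
    ... | yes large = inj₁ (y , here refl , large)
    ... | no  small with search ys
    ...   | inj₁ (x , x∈ys , large) = inj₁ (x , there x∈ys , large)
    ...   | inj₂ rest = inj₂ (≤-trans (≤-reflexive (*-distribˡ-+ q (f y) _))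
                                      (+-mono-≤ (≤-pred (≰⇒> small)) rest))
  ... | inj₁ found = found
  ... | inj₂ small = contradiction big (<⇒≱ (begin-strict
    q * Σ[ xs ] f ≤⟨ small ⟩
    length xs * c ≤⟨ *-monoˡ-≤ c len ⟩
    N * c         <⟨ *-monoʳ-< N {{>-nonZero N>0}} (n<1+n c) ⟩
    N * suc c     ∎))
    where open ≤-Reasoning

  -- The partner of the first element is deleted from `ys`; injectivity of `R` keeps any later
  -- element from being matched to the deleted occurrence. A relation is used because partners are
  -- not canonical: a clique has many enumerations, a selection of edges many transversals.
  length-≤-by-relation : {R : A → B → Set} → (∀ {x x′ y} → R x y → R x′ y → x ≡ x′) →
    ∀ {xs} → Unique xs → ∀ ys → (∀ {x} → x ∈ˡ xs → ∃[ y ] y ∈ˡ ys × R x y) →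
    length xs ≤ length ys
  length-≤-by-relation             inj []       ys total = z≤n
  length-≤-by-relation {A} {B} {R} inj {x ∷ xs} (x∉xs ∷ uniq) ys total
    with total (here refl)
  ... | y , y∈ys , Rxy with Mem.∈-∃++ y∈ys
  ... | as , bs , refl = begin
    suc (length xs)                 ≤⟨ s≤s (length-≤-by-relation inj uniq (as ++ bs) total′) ⟩
    suc (length (as ++ bs))         ≡⟨ cong suc (List.length-++ as) ⟩
    suc (length as + length bs)     ≡⟨ sym (+-suc (length as) (length bs)) ⟩
    length as + length (y ∷ bs)     ≡⟨ sym (List.length-++ as) ⟩
    length (as ++ y ∷ bs)           ∎
    where
    open ≤-Reasoning
    total′ : ∀ {x′} → x′ ∈ˡ xs → ∃[ y′ ] y′ ∈ˡ as ++ bs × R x′ y′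
    total′ x′∈xs with total (there x′∈xs)
    ... | y′ , y′∈ , Rx′y′ with Mem.∈-++⁻ as y′∈
    ... | inj₁ y′∈as          = y′ , Mem.∈-++⁺ˡ y′∈as , Rx′y′
    ... | inj₂ (there y′∈bs)  = y′ , Mem.∈-++⁺ʳ as y′∈bs , Rx′y′
    ... | inj₂ (here refl)    = ⊥-elim (All-lookup x∉xs x′∈xs (inj Rxy Rx′y′))

  -- Lists of all tuples.

  -- The tail runs in the outer loop, so a sum over longer tuples unfolds into a sum over tails `w`
  -- of sums over first entries, the shape needed when the first coordinate is replaced.
  tuples : List A → ∀ m → List (Vec A m)
  tuples xs zero    = [] ∷ []
  tuples xs (suc m) = cartesianProductWith (λ w v → v ∷ w) (tuples xs m) xs

  length-Σ : (xs : List A) → length xs ≡ Σ[ xs ] (λ _ → 1)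
  length-Σ xs = sym (trans (Σ-const 1 xs) (*-identityˡ _))

  length-tuples : ∀ (xs : List A) m → length (tuples xs m) ≡ length xs ^ m
  length-tuples xs zero    = refl
  length-tuples xs (suc m) = begin
    length (tuples xs (suc m))                             ≡⟨ length-Σ (tuples xs (suc m)) ⟩
    Σ[ tuples xs (suc m) ] (λ _ → 1)                       ≡⟨ Σ-cartesianProductWith _ (tuples xs m) xs _ ⟩
    Σ[ tuples xs m ] (λ _ → Σ[ xs ] (λ _ → 1))             ≡⟨ Σ-const _ (tuples xs m) ⟩
    Σ[ xs ] (λ _ → 1) * length (tuples xs m)               ≡⟨ cong₂ _*_ (sym (length-Σ xs)) (length-tuples xs m) ⟩
    length xs ^ suc m                                      ∎
    where open ≡-Reasoning

  tuples-complete : ∀ {xs : List A} → (∀ x → x ∈ˡ xs) → ∀ {m} (t : Vec A m) → t ∈ˡ tuples xs m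
  tuples-complete all []      = here refl
  tuples-complete all (v ∷ t) = Mem.∈-cartesianProductWith⁺ _ (tuples-complete all t) (all v)

  tuples-unique : ∀ {xs : List A} → Unique xs → ∀ m → Unique (tuples xs m)
  tuples-unique uniq zero    = [] ∷ []
  tuples-unique uniq (suc m) =
    Uniq.cartesianProductWith⁺ _ (λ eq → Vec.∷-injectiveʳ eq , Vec.∷-injectiveˡ eq) (tuples-unique uniq m) uniq

  finTuples : ∀ n m → List (Vec (Fin n) m)
  finTuples n = tuples (allFin n)

  length-finTuples : ∀ n m → length (finTuples n m) ≡ n ^ m
  length-finTuples n m = trans (length-tuples (allFin n) m) (cong (_^ m) (List.length-tabulate (id {A = Fin n})))

  -- Boolean tests on subsets.

  ∧-true⁻ : ∀ a {b} → a ∧ b ≡ true → a ≡ true × b ≡ true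
  ∧-true⁻ true eq = refl , eq

  ⊆ᵇ⇒⊆ : ∀ {n} (p q : Subset n) → p ⊆ᵇ q ≡ true → p ⊆ q
  ⊆ᵇ⇒⊆ (false ∷ p) (b ∷ q)    eq = Sub.out⊆ (⊆ᵇ⇒⊆ p q eq)
  ⊆ᵇ⇒⊆ (true ∷ p)  (true ∷ q) eq = Sub.in⊆in (⊆ᵇ⇒⊆ p q eq)

  ⊆⇒⊆ᵇ : ∀ {n} (p q : Subset n) → p ⊆ q → p ⊆ᵇ q ≡ true
  ⊆⇒⊆ᵇ []          []          p⊆q = refl
  ⊆⇒⊆ᵇ (false ∷ p) (b ∷ q)     p⊆q = ⊆⇒⊆ᵇ p q (Sub.drop-∷-⊆ p⊆q)
  ⊆⇒⊆ᵇ (true ∷ p)  (true ∷ q)  p⊆q = ⊆⇒⊆ᵇ p q (Sub.drop-∷-⊆ p⊆q)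
  ⊆⇒⊆ᵇ (true ∷ p)  (false ∷ q) p⊆q with () ← p⊆q here

  ∈-tabulate⁺ : ∀ {n} (p : Fin n → Bool) {v} → p v ≡ true → v ∈ tabulate p
  ∈-tabulate⁺ p {v} pv = Vec.lookup⇒[]= v (tabulate p) (trans (Vec.lookup∘tabulate p v) pv)

  ∈-tabulate⁻ : ∀ {n} (p : Fin n → Bool) {v} → v ∈ tabulate p → p v ≡ true
  ∈-tabulate⁻ p {v} v∈ = trans (sym (Vec.lookup∘tabulate p v)) (Vec.[]=⇒lookup v∈)

  count-allFin : ∀ {n} (p : Fin n → Bool) → count p (allFin n) ≡ ∣ tabulate p ∣
  count-allFin {n} p = trans (cong sum (List.map-tabulate id (indicator ∘ p))) (go p)
    where
    go : ∀ {n} (p : Fin n → Bool) → sum (List.tabulate (indicator ∘ p)) ≡ ∣ tabulate p ∣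
    go {zero}  p = refl
    go {suc n} p with p zero
    ... | true  = cong suc (go (p ∘ suc))
    ... | false = go (p ∘ suc)

  -- Replacing the coordinates of a dense family of tuples by sets.

  ^-distribʳ-* : ∀ a b m → (a * b) ^ m ≡ a ^ m * b ^ m
  ^-distribʳ-* a b zero    = refl
  ^-distribʳ-* a b (suc m) = trans (cong (a * b *_) (^-distribʳ-* a b m)) (rearrange a b (a ^ m) (b ^ m))
    where
    rearrange : ∀ a b c d → a * b * (c * d) ≡ a * c * (b * d)
    rearrange = solve-∀

  -- Replacing one coordinate turns density 1/q into density 1/nextDensity M e q and uses richness
  -- only for sets of at least n/(2q) vertices; scale adds up these thresholds 2q over all m steps.
  nextDensity : ℕ → ℕ → ℕ → ℕ
  nextDensity M e q = 2 * q * ((2 * q) ^ M * e)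

  scale : ℕ → ℕ → ℕ → ℕ → ℕ
  scale M e zero    q = 0
  scale M e (suc m) q = 2 * q + scale M e m (nextDensity M e q)

  module _ {n : ℕ} {{_ : NonZero n}} (M e : ℕ) (Us : List (Subset n)) (few : length Us ≤ n ^ M) where

    -- A supersaturation hypothesis: a set of at least n/D vertices contains members of `Us`
    -- numbering at least a fraction 1/e of all its `M`-tuples. It grows stronger with `D`. It is
    -- applied with `Us` the non-clique images of `M`-tuples, listed with repetitions.
    Rich : ℕ → Set
    Rich D = ∀ W → n ≤ D * ∣ W ∣ → ∣ W ∣ ^ M ≤ e * count (_⊆ᵇ W) Us

    extensions : ∀ {m} → (Vec (Fin n) (suc m) → Bool) → Vec (Fin n) m → Subset n
    extensions G w = tabulate (λ v → G (v ∷ w))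

    count-extensions : ∀ {m} (G : Vec (Fin n) (suc m) → Bool) →
      count G (finTuples n (suc m)) ≡ Σ[ finTuples n m ] (λ w → ∣ extensions G w ∣)
    count-extensions {m} G = trans (Σ-cartesianProductWith _ (finTuples n m) (allFin n) _)
      (cong sum (List.map-cong (λ w → count-allFin (λ v → G (v ∷ w))) (finTuples n m)))

    -- Sets W with |W| < n/d contribute little; the others are handled by richness.
    weigh : ∀ d → Rich d → ∀ W →
      d * n ^ M * ∣ W ∣ ≤ n * n ^ M + d * n * (d ^ M * e) * count (_⊆ᵇ W) Us
    weigh d rich W with n ≤? d * ∣ W ∣
    ... | no small = ≤-trans (begin
        d * n ^ M * ∣ W ∣ ≡⟨ r₁ d (n ^ M) ∣ W ∣ ⟩
        d * ∣ W ∣ * n ^ M ≤⟨ *-monoˡ-≤ (n ^ M) (<⇒≤ (≰⇒> small)) ⟩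
        n * n ^ M         ∎) (m≤m+n _ _)
      where
      open ≤-Reasoning
      r₁ : ∀ a b c → a * b * c ≡ a * c * b
      r₁ = solve-∀
    -- Raising `n ≤ d * ∣ W ∣` to the power `M` costs the factor `d ^ M` and turns the richness
    -- bound, relative to the size of `W`, into one relative to `n`.
    ... | yes large = ≤-trans (begin
        d * n ^ M * ∣ W ∣                ≤⟨ *-monoʳ-≤ (d * n ^ M) (Sub.∣p∣≤n W) ⟩
        d * n ^ M * n                    ≤⟨ *-monoˡ-≤ n (*-monoʳ-≤ d (^-monoˡ-≤ M large)) ⟩
        d * (d * ∣ W ∣) ^ M * n          ≡⟨ cong (λ z → d * z * n) (^-distribʳ-* d ∣ W ∣ M) ⟩
        d * (d ^ M * ∣ W ∣ ^ M) * n      ≤⟨ *-monoˡ-≤ n (*-monoʳ-≤ d (*-monoʳ-≤ (d ^ M) (rich W large))) ⟩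
        d * (d ^ M * (e * c)) * n        ≡⟨ r₂ d (d ^ M) e c n ⟩
        d * n * (d ^ M * e) * c          ∎) (m≤n+m _ _)
      where
      open ≤-Reasoning
      c = count (_⊆ᵇ W) Us
      r₂ : ∀ d dM e c n → d * (dM * (e * c)) * n ≡ d * n * (dM * e) * c
      r₂ = solve-∀

    -- Sum `weigh` over all tails. With threshold `2 * q`, the density makes the left side at least
    -- twice `n * n ^ M * n ^ m`; the tails with few extensions account for at most one half, and
    -- after exchanging sums the other half counts pairs of a set `U` and a tail all of whose
    -- prefixes from `U` are good.
    doubleCount : ∀ {m} q (G : Vec (Fin n) (suc m) → Bool) → Rich (2 * q) →
      n ^ suc m ≤ q * count G (finTuples n (suc m)) →
      n ^ M * n ^ m ≤ nextDensity M e q *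
        Σ[ Us ] (λ U → count (λ w → U ⊆ᵇ extensions G w) (finTuples n m))
    doubleCount {m} q G rich dense = *-cancelˡ-≤ n (+-cancelˡ-≤ (n * nM * nm) _ _ (begin
      n * nM * nm + n * (nM * nm)            ≡⟨ r₁ n nM nm ⟩
      2 * nM * (n * nm)                      ≤⟨ *-monoʳ-≤ (2 * nM) dense ⟩
      2 * nM * (q * count G (finTuples n (suc m))) ≡⟨ cong (λ z → 2 * nM * (q * z)) (count-extensions G) ⟩
      2 * nM * (q * Σ[ ws ] (λ w → ∣ N w ∣)) ≡⟨ r₂ nM q _ ⟩
      d * nM * Σ[ ws ] (λ w → ∣ N w ∣)       ≡⟨ sym (Σ-*ˡ (d * nM) ws _) ⟩
      Σ[ ws ] (λ w → d * nM * ∣ N w ∣)       ≤⟨ Σ-mono ws (λ w → weigh d rich (N w)) ⟩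
      Σ[ ws ] (λ w → n * nM + K * c w)       ≡⟨ Σ-+ ws _ _ ⟩
      Σ[ ws ] (λ _ → n * nM) + Σ[ ws ] (λ w → K * c w)
        ≡⟨ cong₂ _+_ (trans (Σ-const (n * nM) ws) (cong (n * nM *_) (length-finTuples n m)))
                     (trans (Σ-*ˡ K ws c) (cong (K *_) (Σ-swap ws Us _))) ⟩
      n * nM * nm + K * S                    ≡⟨ cong (n * nM * nm +_) (r₃ d n (d ^ M * e) S) ⟩
      n * nM * nm + n * (d * (d ^ M * e) * S) ∎))
      where
      open ≤-Reasoning
      nM = n ^ M
      nm = n ^ m
      d = 2 * q
      K = d * n * (d ^ M * e)
      ws = finTuples n m
      N = extensions G
      c : Vec (Fin n) m → ℕ
      c w = count (_⊆ᵇ N w) Us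
      S = Σ[ Us ] (λ U → count (λ w → U ⊆ᵇ N w) ws)
      r₁ : ∀ n a b → n * a * b + n * (a * b) ≡ 2 * a * (n * b)
      r₁ = solve-∀
      r₂ : ∀ a q s → 2 * a * (q * s) ≡ 2 * q * a * s
      r₂ = solve-∀
      r₃ : ∀ d n x s → d * n * x * s ≡ n * (d * x * s)
      r₃ = solve-∀

    -- Induction on `m`. The pigeonhole principle yields one `U₀` inside the extensions of many
    -- tails, and the next predicate is precisely that `U₀` lies in the extensions of `w`; a
    -- transversal of the later sets may then be prefixed by any vertex of `U₀`.
    blowup : ∀ m q (G : Vec (Fin n) m → Bool) → Rich (scale M e m q) →
      n ^ m ≤ q * count G (finTuples n m) →
      Σ (Fin m → Subset n) λ U → (∀ i → U i ∈ˡ Us) ×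
        (∀ t → (∀ i → lookup t i ∈ U i) → G t ≡ true)
    blowup zero q G rich dense = (λ ()) , (λ ()) , λ { [] _ → holds }
      where
      holds : G [] ≡ true
      holds with G []
      ... | true  = refl
      ... | false = contradiction dense (<⇒≱ (≤-reflexive (cong suc (*-zeroʳ q))))
    blowup (suc m) q G rich dense
      with pigeonhole (n ^ M) (nextDensity M e q) (n ^ m) Us _ few (m^n>0 n M) (m^n>0 n m)
             (doubleCount q G (λ W n≤ → rich W (≤-trans n≤ (*-monoˡ-≤ ∣ W ∣ (m≤m+n (2 * q) _)))) dense)
    ... | U₀ , U₀∈Us , dense′
      with blowup m (nextDensity M e q) (λ w → U₀ ⊆ᵇ extensions G w)
             (λ W n≤ → rich W (≤-trans n≤ (*-monoˡ-≤ ∣ W ∣ (m≤n+m _ (2 * q))))) dense′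
    ... | U , U∈Us , complete =
        (λ { zero → U₀ ; (suc i) → U i })
      , (λ { zero → U₀∈Us ; (suc i) → U∈Us i })
      , λ { (v ∷ t) t∈U → ∈-tabulate⁻ (λ v → G (v ∷ t))
            (⊆ᵇ⇒⊆ U₀ (extensions G t) (complete t (t∈U ∘ suc)) (t∈U zero)) }

  -- Cliques and missing edges.

  allᵇ-false⁻ : ∀ {A : Set} (p : A → Bool) xs → allᵇ p xs ≡ false → ∃[ x ] p x ≡ false
  allᵇ-false⁻ p (x ∷ xs) eq with p x in px
  ... | true  = allᵇ-false⁻ p xs eq
  ... | false = x , px

  allᵇ-true⁻ : ∀ {A : Set} (p : A → Bool) {xs} → allᵇ p xs ≡ true → ∀ {x} → x ∈ˡ xs → p x ≡ true
  allᵇ-true⁻ p {x ∷ xs} eq (here refl) = proj₁ (∧-true⁻ (p x) eq)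
  allᵇ-true⁻ p {x ∷ xs} eq (there x∈)  = allᵇ-true⁻ p (proj₂ (∧-true⁻ (p x) eq)) x∈

  allSubsets-complete : ∀ (S : Subset n) → S ∈ˡ allSubsets n
  allSubsets-complete []          = here refl
  allSubsets-complete (false ∷ S) = Mem.∈-++⁺ˡ (Mem.∈-map⁺ (false ∷_) (allSubsets-complete S))
  allSubsets-complete (true ∷ S)  = Mem.∈-++⁺ʳ (map (false ∷_) (allSubsets _)) (Mem.∈-map⁺ (true ∷_) (allSubsets-complete S))

  allSubsets-unique : ∀ n → Unique (allSubsets n)
  allSubsets-unique zero    = [] ∷ []
  allSubsets-unique (suc n) = Uniq.++⁺ (Uniq.map⁺ Vec.∷-injectiveʳ (allSubsets-unique n))
                                       (Uniq.map⁺ Vec.∷-injectiveʳ (allSubsets-unique n)) disjoint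
    where
    disjoint : ∀ {S} → ¬ (S ∈ˡ map (false ∷_) (allSubsets n) × S ∈ˡ map (true ∷_) (allSubsets n))
    disjoint (S∈ , S∈′) with Mem.∈-map⁻ (false ∷_) S∈ | Mem.∈-map⁻ (true ∷_) S∈′
    ... | _ , _ , refl | _ , _ , ()

  ≡⇒≡ᵇ-true : ∀ {a b} → a ≡ b → (a ≡ᵇ b) ≡ true
  ≡⇒≡ᵇ-true {a} {b} eq with a ≡ᵇ b | ≡⇒≡ᵇ a b eq
  ... | true | _ = refl

  ≡ᵇ-true⇒≡ : ∀ a b → (a ≡ᵇ b) ≡ true → a ≡ b
  ≡ᵇ-true⇒≡ a b eq = ≡ᵇ⇒≡ a b (subst T (sym eq) tt)

  ¬Clique⇒missing : ∀ (H : Hypergraph k n) S → isCliqueᵇ H S ≡ false →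
                    ∃[ T ] T ⊆ S × IsMissingEdge H T
  ¬Clique⇒missing {k} H S eq with allᵇ-false⁻ _ (allSubsets _) eq
  ... | T , failure with T ⊆ᵇ S in T⊆S | ∣ T ∣ ≡ᵇ k in size | edge H T in miss
  ... | true | true | false = T , ⊆ᵇ⇒⊆ T S T⊆S , ≡ᵇ-true⇒≡ _ k size , miss

  Clique⇒edge : ∀ (H : Hypergraph k n) S → IsClique H S → ∀ T → T ⊆ S → ∣ T ∣ ≡ k → edge H T ≡ true
  Clique⇒edge H S clique T T⊆S size with allᵇ-true⁻ _ clique (allSubsets-complete T)
  ... | holds rewrite ⊆⇒⊆ᵇ T S T⊆S | ≡⇒≡ᵇ-true size = holds

  isClique⁺ : ∀ (H : Hypergraph k n) S → (∀ T → T ⊆ S → ∣ T ∣ ≡ k → edge H T ≡ true) → IsClique H S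
  isClique⁺ H S edges with isCliqueᵇ H S in eq
  ... | true  = refl
  ... | false with ¬Clique⇒missing H S eq
  ...   | T , T⊆S , size , miss with () ← trans (sym miss) (edges T T⊆S size)

  clique-⊆ : ∀ (H : Hypergraph k n) {S S′} → S ⊆ S′ → IsClique H S′ → IsClique H S
  clique-⊆ H {S} {S′} S⊆S′ clique = isClique⁺ H S λ T T⊆S → Clique⇒edge H S′ clique T (Sub.⊆-trans T⊆S S⊆S′)

  -- Vacuous, since `S` has no subset of size `k`. It provides the empty set and single vertices as
  -- cliques when `n` is small.
  small-clique : ∀ (H : Hypergraph k n) S → ∣ S ∣ < k → IsClique H S
  small-clique H S small = isClique⁺ H S λ T T⊆S size →
    contradiction (≤-trans (≤-reflexive (sym size)) (Sub.p⊆q⇒∣p∣≤∣q∣ T⊆S)) (<⇒≱ small)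

  ∈-image⁺ : ∀ (t : Fin M → Fin n) i → t i ∈ image t
  ∈-image⁺ t i = ∈-tabulate⁺ _ attained
    where
    attained : ⌊ any? (λ j → t j ≟ t i) ⌋ ≡ true
    attained with any? (λ j → t j ≟ t i)
    ... | yes _ = refl
    ... | no ¬p = contradiction (i , refl) ¬p

  ∈-image⁻ : ∀ (t : Fin M → Fin n) {v} → v ∈ image t → ∃[ i ] t i ≡ v
  ∈-image⁻ t {v} v∈ with any? (λ j → t j ≟ v) | ∈-tabulate⁻ (λ v → ⌊ any? (λ j → t j ≟ v) ⌋) v∈
  ... | yes p | _ = p

  -- Cliques as tuples with distinct entries.

  Distinct : Vec (Fin n) M → Set
  Distinct t = ∀ i j → lookup t i ≡ lookup t j → i ≡ j

  distinct? : (t : Vec (Fin n) M) → Dec (Distinct t)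
  distinct? t = all? λ i → all? λ j → (lookup t i ≟ lookup t j) →-dec (i ≟ j)

  elements : ∀ (S : Subset n) → Σ (Vec (Fin n) ∣ S ∣) λ t →
       Distinct t × (∀ i → lookup t i ∈ S) × (∀ {v} → v ∈ S → ∃[ i ] lookup t i ≡ v)
  elements []          = [] , (λ ()) , (λ ()) , λ ()
  elements (false ∷ S) with t , distinct , t∈S , S∈t ← elements S =
      Vec.map suc t
    , (λ i j eq → distinct i j (suc-injective (trans (sym (Vec.lookup-map i suc t)) (trans eq (Vec.lookup-map j suc t)))))
    , (λ i → subst (_∈ false ∷ S) (sym (Vec.lookup-map i suc t)) (there (t∈S i)))
    , λ { (there v∈) → let i , eq = S∈t v∈ in i , trans (Vec.lookup-map i suc t) (cong suc eq) }
  elements (true ∷ S)  with t , distinct , t∈S , S∈t ← elements S =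
      zero ∷ Vec.map suc t
    , (λ { zero    zero    eq → refl
         ; zero    (suc j) eq → contradiction (trans eq (Vec.lookup-map j suc t)) λ ()
         ; (suc i) zero    eq → contradiction (trans (sym eq) (Vec.lookup-map i suc t)) λ ()
         ; (suc i) (suc j) eq → cong suc (distinct i j (suc-injective
             (trans (sym (Vec.lookup-map i suc t)) (trans eq (Vec.lookup-map j suc t))))) })
    , (λ { zero → here ; (suc i) → subst (_∈ true ∷ S) (sym (Vec.lookup-map i suc t)) (there (t∈S i)) })
    , λ { here → zero , refl
        ; (there v∈) → let i , eq = S∈t v∈ in suc i , trans (Vec.lookup-map i suc t) (cong suc eq) }

  enumerate : ∀ (S : Subset n) → Σ (Vec (Fin n) ∣ S ∣) λ t → Distinct t × image (lookup t) ≡ S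
  enumerate S = let t , distinct , t∈S , S∈t = elements S in t , distinct ,
    Sub.⊆-antisym (λ v∈ → let i , eq = ∈-image⁻ (lookup t) v∈ in subst (_∈ S) eq (t∈S i))
                  (λ v∈ → let i , eq = S∈t v∈ in subst (_∈ image (lookup t)) eq (∈-image⁺ (lookup t) i))

  -- Distinctness of the entries is what makes the missing edges found in the end disjoint.
  isCliqueTupleᵇ : Hypergraph k n → Vec (Fin n) M → Bool
  isCliqueTupleᵇ H t = isCliqueᵇ H (image (lookup t)) ∧ ⌊ distinct? t ⌋

  isCliqueTuple⁻ : ∀ (H : Hypergraph k n) (t : Vec (Fin n) M) → isCliqueTupleᵇ H t ≡ true →
                   IsClique H (image (lookup t)) × Distinct t
  isCliqueTuple⁻ H t eq with isCliqueᵇ H (image (lookup t)) | distinct? t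
  ... | true | yes d = refl , d

  isCliqueTuple⁺ : ∀ (H : Hypergraph k n) (t : Vec (Fin n) M) →
                   IsClique H (image (lookup t)) → Distinct t → isCliqueTupleᵇ H t ≡ true
  isCliqueTuple⁺ H t clique d rewrite clique with distinct? t
  ... | yes _ = refl
  ... | no ¬d = contradiction d ¬d

  T⇒≡true : ∀ {b} → T b → b ≡ true
  T⇒≡true {true} _ = refl

  -- Every clique on `m` vertices is enumerated by some tuple with distinct entries, and a tuple has
  -- only one image. The gain of a factor m! from reordering is given away.
  cliqueCount≤ : ∀ m (H : Hypergraph k n) → cliqueCount m H ≤ count (isCliqueTupleᵇ H) (finTuples n m)
  cliqueCount≤ {n = n} m H = ≤-trans
    (length-≤-by-relation {R = λ S t → image (lookup t) ≡ S} (λ eq eq′ → trans (sym eq) eq′)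
      (Uniq.filter⁺ _ (allSubsets-unique n)) (filter (T? ∘ isCliqueTupleᵇ H) (finTuples n m)) listed)
    (≤-reflexive (length-filter-T? (isCliqueTupleᵇ H) (finTuples n m)))
    where
    listed : ∀ {S} → S ∈ˡ filter (λ S → T? (isCliqueᵇ H S ∧ (∣ S ∣ ≡ᵇ m))) (allSubsets n) →
             ∃[ t ] t ∈ˡ filter (T? ∘ isCliqueTupleᵇ H) (finTuples n m) × image (lookup t) ≡ S
    listed {S} S∈ with clique , size ← ∧-true⁻ (isCliqueᵇ H S)
        (T⇒≡true (proj₂ (Mem.∈-filter⁻ (λ S → T? (isCliqueᵇ H S ∧ (∣ S ∣ ≡ᵇ m))) {xs = allSubsets n} S∈)))
      with refl ← ≡ᵇ-true⇒≡ ∣ S ∣ m size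
      with t , distinct , image≡S ← enumerate S =
        t , Mem.∈-filter⁺ (T? ∘ isCliqueTupleᵇ H) (tuples-complete Mem.∈-allFin t)
              (subst T (sym (isCliqueTuple⁺ H t (subst (IsClique H) (sym image≡S) clique) distinct)) tt)
          , image≡S

  -- Disjoint missing edges and the abundance of non-cliques.

  nonCliques : Hypergraph k n → ℕ → List (Subset n)
  nonCliques {n = n} H M =
    filter (λ S → isCliqueᵇ H S Bool.≟ false) (map (image ∘ lookup) (finTuples n M))

  length-nonCliques : ∀ (H : Hypergraph k n) M → length (nonCliques H M) ≤ n ^ M
  length-nonCliques {n = n} H M = ≤-trans (List.length-filter _ (map (image ∘ lookup) (finTuples n M)))
    (≤-reflexive (trans (List.length-map (image ∘ lookup) (finTuples n M)) (length-finTuples n M)))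

  disjoint-∉ : ∀ {A B : Subset n} {v} → A ∩ B ≡ ⊥ → v ∈ A → v ∉ B
  disjoint-∉ eq v∈A v∈B = Sub.∉⊥ (subst (_ ∈_) eq (Sub.x∈p∩q⁺ (v∈A , v∈B)))

  disjoint⁺ : ∀ {A B : Subset n} → (∀ {v} → v ∈ A → v ∉ B) → A ∩ B ≡ ⊥
  disjoint⁺ {A = A} {B} h = Sub.Empty-unique λ (v , v∈) → let v∈A , v∈B = Sub.x∈p∩q⁻ A B v∈ in h v∈A v∈B

  x∈p─q⇒x∉q : ∀ (p q : Subset n) {v} → v ∈ p ─ q → v ∉ q
  x∈p─q⇒x∉q (_ ∷ p) (true ∷ q)  ()          here
  x∈p─q⇒x∉q (_ ∷ p) (_ ∷ q)     (there v∈) (there v∈q) = x∈p─q⇒x∉q p q v∈ v∈q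

  ∣p∣≤∣p─q∣+∣q∣ : ∀ (p q : Subset n) → ∣ p ∣ ≤ ∣ p ─ q ∣ + ∣ q ∣
  ∣p∣≤∣p─q∣+∣q∣ []          []          = z≤n
  ∣p∣≤∣p─q∣+∣q∣ (true ∷ p)  (true ∷ q)  = ≤-trans (s≤s (∣p∣≤∣p─q∣+∣q∣ p q)) (≤-reflexive (sym (+-suc _ _)))
  ∣p∣≤∣p─q∣+∣q∣ (true ∷ p)  (false ∷ q) = s≤s (∣p∣≤∣p─q∣+∣q∣ p q)
  ∣p∣≤∣p─q∣+∣q∣ (false ∷ p) (true ∷ q)  = ≤-trans (∣p∣≤∣p─q∣+∣q∣ p q) (+-monoʳ-≤ _ (n≤1+n _))
  ∣p∣≤∣p─q∣+∣q∣ (false ∷ p) (false ∷ q) = ∣p∣≤∣p─q∣+∣q∣ p q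

  -- Take a missing edge, delete its `k` vertices and repeat. The hypothesis covers every subset
  -- that has lost at most `r * k` vertices, so it passes to the remaining set with `r` lowered by
  -- one.
  greedyMissing : ∀ (H : Hypergraph k n) r W →
    (∀ W′ → W′ ⊆ W → ∣ W ∣ ≤ ∣ W′ ∣ + r * k → isCliqueᵇ H W′ ≡ false) →
    Σ (Fin r → Subset n) λ f → (∀ i → f i ⊆ W) × (∀ i → IsMissingEdge H (f i)) ×
      (∀ i j → ¬ i ≡ j → f i ∩ f j ≡ ⊥)
  greedyMissing H zero W _ = (λ ()) , (λ ()) , (λ ()) , λ ()
  greedyMissing {k} H (suc r) W dense with ¬Clique⇒missing H W (dense W id (m≤m+n _ _))
  ... | T , T⊆W , T-missing@(size , _) with greedyMissing H r (W ─ T) dense′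
    where
    open ≤-Reasoning
    dense′ : ∀ W′ → W′ ⊆ W ─ T → ∣ W ─ T ∣ ≤ ∣ W′ ∣ + r * k → isCliqueᵇ H W′ ≡ false
    dense′ W′ W′⊆ big = dense W′ (Sub.⊆-trans W′⊆ (Sub.p─q⊆p W T)) (begin
      ∣ W ∣                     ≤⟨ ∣p∣≤∣p─q∣+∣q∣ W T ⟩
      ∣ W ─ T ∣ + ∣ T ∣         ≡⟨ cong (∣ W ─ T ∣ +_) size ⟩
      ∣ W ─ T ∣ + k             ≤⟨ +-monoˡ-≤ k big ⟩
      ∣ W′ ∣ + r * k + k        ≡⟨ +-assoc ∣ W′ ∣ (r * k) k ⟩
      ∣ W′ ∣ + (r * k + k)      ≡⟨ cong (∣ W′ ∣ +_) (+-comm (r * k) k) ⟩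
      ∣ W′ ∣ + suc r * k        ∎)
  ... | f , f⊆ , f-missing , f-disjoint =
      (λ { zero → T ; (suc i) → f i })
    , (λ { zero → T⊆W ; (suc i) → Sub.⊆-trans (f⊆ i) (Sub.p─q⊆p W T) })
    , (λ { zero → T-missing ; (suc i) → f-missing i })
    , λ { zero    zero    i≢j → contradiction refl i≢j
        ; zero    (suc j) i≢j → disjoint⁺ λ v∈T v∈fj → x∈p─q⇒x∉q W T (f⊆ j v∈fj) v∈T
        ; (suc i) zero    i≢j → disjoint⁺ λ v∈fi v∈T → x∈p─q⇒x∉q W T (f⊆ i v∈fi) v∈T
        ; (suc i) (suc j) i≢j → f-disjoint i j (i≢j ∘ cong suc) }

  -- Bridges transversals given as vectors, which can be searched exhaustively, and transversals
  -- given as functions, as in the definition. The two images are related by inclusion, and cliques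
  -- are closed under subsets.
  completeTuple : ∀ (H : Hypergraph k n) (τ : Fin M → Subset n) →
    (∀ i → IsMissingEdge H (τ i)) → (∀ i j → ¬ i ≡ j → τ i ∩ τ j ≡ ⊥) →
    (∀ (t : Vec (Fin n) M) → (∀ i → lookup t i ∈ τ i) → IsClique H (image (lookup t))) →
    HasCompleteTuple M H
  completeTuple H τ missing disjoint cliques = τ , missing , disjoint , λ t t∈τ →
    clique-⊆ H (λ v∈ → let i , eq = ∈-image⁻ t v∈ in
        subst (_∈ image (lookup (tabulate t))) (trans (Vec.lookup∘tabulate t i) eq)
          (∈-image⁺ (lookup (tabulate t)) i))
      (cliques (tabulate t) λ i → subst (_∈ τ i) (sym (Vec.lookup∘tabulate t i)) (t∈τ i))

  -- A search through the finite list of tuples makes the witness explicit: if it finds none, all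
  -- transversals are cliques and `τ` is a complete tuple.
  nonCliqueTransversal : ∀ (H : Hypergraph k n) → ¬ HasCompleteTuple M H → ∀ (τ : Fin M → Subset n) →
    (∀ i → IsMissingEdge H (τ i)) → (∀ i j → ¬ i ≡ j → τ i ∩ τ j ≡ ⊥) →
    ∃[ t ] (∀ i → lookup t i ∈ τ i) × isCliqueᵇ H (image (lookup t)) ≡ false
  nonCliqueTransversal {n = n} {M = M} H noTuple τ missing disjoint
    with Any.any? (λ t → all? (λ i → lookup t i Sub.∈? τ i) ×-dec
                         (isCliqueᵇ H (image (lookup t)) Bool.≟ false)) (finTuples n M)
  ... | yes found = let t , _ , prop = find found in t , prop
  ... | no  none  = contradiction (completeTuple H τ missing disjoint cliques) noTuple
    where
    cliques : ∀ (t : Vec (Fin n) M) → (∀ i → lookup t i ∈ τ i) → IsClique H (image (lookup t))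
    cliques t t∈τ with isCliqueᵇ H (image (lookup t)) in eq
    ... | true  = refl
    ... | false = contradiction (lose (tuples-complete Mem.∈-allFin t) (t∈τ , eq)) none

  -- The relation pairing a selection of blocks with the image of a transversal is injective
  -- because the blocks are pairwise disjoint.
  manyNonCliques : ∀ (H : Hypergraph k n) → ¬ HasCompleteTuple M H → ∀ s W (f : Fin (M * s) → Subset n) →
    (∀ i → f i ⊆ W) → (∀ i → IsMissingEdge H (f i)) → (∀ i j → ¬ i ≡ j → f i ∩ f j ≡ ⊥) →
    s ^ M ≤ count (_⊆ᵇ W) (nonCliques H M)
  manyNonCliques {n = n} {M = M} H noTuple s W f f⊆W missing disjoint = begin
    s ^ M                          ≡⟨ sym (length-finTuples s M) ⟩
    length (finTuples s M)         ≤⟨ length-≤-by-relation {R = Selects} selects-injective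
                                       (tuples-unique (Uniq.allFin⁺ s) M) _ (λ {b} _ → selected b) ⟩
    length (filter (T? ∘ (_⊆ᵇ W)) (nonCliques H M)) ≡⟨ length-filter-T? (_⊆ᵇ W) (nonCliques H M) ⟩
    count (_⊆ᵇ W) (nonCliques H M) ∎
    where
    open ≤-Reasoning
    block : Vec (Fin s) M → Fin M → Subset n
    -- The `M * s` edges form `M` classes of `s`: `combine j` addresses class `j`, and `b` selects
    -- one edge from each class.
    block b j = f (combine j (lookup b j))

    Selects : Vec (Fin s) M → Subset n → Set
    Selects b U = ∃[ t ] U ≡ image (lookup t) × (∀ j → lookup t j ∈ block b j)

    index-unique : ∀ {v i j} → v ∈ f i → v ∈ f j → i ≡ j
    index-unique {i = i} {j} v∈i v∈j with i ≟ j
    ... | yes i≡j = i≡j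
    ... | no  i≢j = contradiction v∈j (disjoint-∉ (disjoint i j i≢j) v∈i)

    selects-injective : ∀ {b b′ U} → Selects b U → Selects b′ U → b ≡ b′
    selects-injective {b} {b′} (t , refl , t∈) (t′ , eq , t′∈) =
      trans (sym (Vec.tabulate∘lookup b)) (trans (Vec.tabulate-cong agree) (Vec.tabulate∘lookup b′))
      where
      agree : ∀ j → lookup b j ≡ lookup b′ j
      -- The vertex of `t` in class `j` occurs in `t′` at some `j′`. Two of the disjoint edges
      -- sharing a vertex have the same index, so class and position within it both agree.
      agree j with j′ , t′j′≡tj ← ∈-image⁻ (lookup t′) (subst (lookup t j ∈_) eq (∈-image⁺ (lookup t) j))
        with refl , same ← combine-injective j (lookup b j) j′ (lookup b′ j′)
               (index-unique (t∈ j) (subst (_∈ block b′ j′) t′j′≡tj (t′∈ j′))) = same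

    selected : ∀ b → ∃[ U ] U ∈ˡ filter (T? ∘ (_⊆ᵇ W)) (nonCliques H M) × Selects b U
    selected b with t , t∈ , nonClique ← nonCliqueTransversal H noTuple (block b) (λ j → missing _)
                      (λ i j i≢j → disjoint _ _ (i≢j ∘ proj₁ ∘ combine-injective i (lookup b i) j (lookup b j))) =
      image (lookup t) ,
      Mem.∈-filter⁺ (T? ∘ (_⊆ᵇ W))
        (Mem.∈-filter⁺ (λ S → isCliqueᵇ H S Bool.≟ false)
          (Mem.∈-map⁺ (image ∘ lookup) (tuples-complete Mem.∈-allFin t)) nonClique)
        (subst T (sym (⊆⇒⊆ᵇ (image (lookup t)) W λ v∈ →
          let j , eq = ∈-image⁻ (lookup t) v∈ in subst (_∈ W) eq (f⊆W _ (t∈ j)))) tt) ,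
      t , refl , t∈

  -- With s = ⌊w/(2kM)⌋, any `M * s` disjoint missing edges cover at most half of `W`. What remains
  -- has at least w/2, hence at least n/(2D), vertices and is no clique, so the greedy choice does
  -- not stop early. The resulting `s ^ M` non-cliques are a fixed fraction of `w ^ M`, since w ≤
  -- 4kMs.
  noBigClique⇒Rich : ∀ k M {n} {{_ : NonZero n}} (H : Hypergraph k n) D .{{_ : NonZero (2 * k * M)}} →
    ¬ HasCompleteTuple M H → 2 * k * M * D ≤ n →
    (∀ S → n ≤ 2 * D * ∣ S ∣ → isCliqueᵇ H S ≡ false) →
    Rich M ((2 * (2 * k * M)) ^ M) (nonCliques H M) (length-nonCliques H M) D
  noBigClique⇒Rich k M {n} H D noTuple large noBig W n≤DW
    = let f , f⊆W , missing , disjoint = greedyMissing H (M * s) W (λ W′ _ big → noBig W′ (remainder W′ big)) in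
    begin
      w ^ M                          ≤⟨ ^-monoˡ-≤ M w≤2cs ⟩
      (2 * c * s) ^ M                ≡⟨ ^-distribʳ-* (2 * c) s M ⟩
      (2 * c) ^ M * s ^ M            ≤⟨ *-monoʳ-≤ ((2 * c) ^ M) (manyNonCliques H noTuple s W f f⊆W missing disjoint) ⟩
      (2 * c) ^ M * count (_⊆ᵇ W) (nonCliques H M) ∎
    where
    open ≤-Reasoning
    c = 2 * k * M
    w = ∣ W ∣
    s = w / c
    D≢0 : ∀ {D} → n ≤ D * w → NonZero D
    D≢0 {zero}  n≤0 = contradiction (>-nonZero⁻¹ n) (≤⇒≯ n≤0)
    D≢0 {suc _} _   = _
    c≤w : c ≤ w
    c≤w = *-cancelˡ-≤ D {{D≢0 n≤DW}} (≤-trans (≤-reflexive (*-comm D c)) (≤-trans large n≤DW))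
    w≤2cs : w ≤ 2 * c * s
    w≤2cs = begin
      w                ≡⟨ m≡m%n+[m/n]*n w c ⟩
      _ + s * c        ≤⟨ +-monoˡ-≤ (s * c) (m%n≤n w c) ⟩
      -- The bound `c ≤ w`, which comes from `n` being large, makes the quotient `s` positive; the
      -- rounding loss of at most `c` is then absorbed by a second `s * c`.
      c + s * c        ≤⟨ +-monoˡ-≤ (s * c) (m≤n*m c s {{>-nonZero (m≥n⇒m/n>0 c≤w)}}) ⟩
      s * c + s * c    ≡⟨ r s c ⟩
      2 * c * s        ∎
      where
      r : ∀ s c → s * c + s * c ≡ 2 * c * s
      r = solve-∀
    remainder : ∀ W′ → w ≤ ∣ W′ ∣ + M * s * k → n ≤ 2 * D * ∣ W′ ∣
    remainder W′ big = ≤-trans n≤DW (≤-trans (*-monoʳ-≤ D (+-cancelʳ-≤ w w (2 * ∣ W′ ∣) (begin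
      w + w                             ≤⟨ +-mono-≤ big big ⟩
      x + M * s * k + (x + M * s * k)   ≡⟨ r x M s k ⟩
      2 * x + s * c                     ≤⟨ +-monoʳ-≤ (2 * x) (m/n*n≤m w c) ⟩
      2 * x + w                         ∎))) (≤-reflexive (r₂ D x)))
      where
      x = ∣ W′ ∣
      r : ∀ x M s k → x + M * s * k + (x + M * s * k) ≡ 2 * x + s * (2 * k * M)
      r = solve-∀
      r₂ : ∀ D x → D * (2 * x) ≡ 2 * D * x
      r₂ = solve-∀

  -- Extraction of the complete tuple.

  -- `blowup` gives non-cliques whose transversals are all cliques with distinct entries, and each
  -- of them contains a missing edge. Two such edges cannot share a vertex: a transversal using it
  -- in both coordinates would have a repeated entry.
  Rich⇒completeTuple : ∀ {k M n} {{_ : NonZero k}} {{_ : NonZero n}} (H : Hypergraph k n) e q →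
    Rich M e (nonCliques H M) (length-nonCliques H M) (scale M e M q) →
    n ^ M ≤ q * count (isCliqueTupleᵇ H) (finTuples n M) → HasCompleteTuple M H
  Rich⇒completeTuple {k} {M} {n} H e q rich dense
    with U , U∈ , good ← blowup M e (nonCliques H M) (length-nonCliques H M) M q (isCliqueTupleᵇ H) rich dense =
    completeTuple H τ (λ i → proj₂ (proj₂ (pick i))) τ-disjoint λ t t∈ →
      proj₁ (isGood t (λ i → proj₁ (proj₂ (pick i)) (t∈ i)))
    where
    pick : ∀ i → ∃[ T ] T ⊆ U i × IsMissingEdge H T
    pick i = ¬Clique⇒missing H (U i)
      (proj₂ (Mem.∈-filter⁻ (λ S → isCliqueᵇ H S Bool.≟ false) {xs = map (image ∘ lookup) (finTuples n M)} (U∈ i)))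
    τ : Fin M → Subset n
    τ i = proj₁ (pick i)
    isGood : ∀ t → (∀ i → lookup t i ∈ U i) → IsClique H (image (lookup t)) × Distinct t
    isGood t t∈ = isCliqueTuple⁻ H t (good t t∈)
    τ-nonempty : ∀ l → ∃[ x ] x ∈ τ l
    τ-nonempty l with Sub.nonempty? (τ l)
    ... | yes nonempty = nonempty
    ... | no  empty    = contradiction
      (trans (sym (proj₁ (proj₂ (proj₂ (pick l))))) (trans (cong ∣_∣ (Sub.Empty-unique empty)) (Sub.∣⊥∣≡0 n)))
      (≢-nonZero⁻¹ k)
    τ-disjoint : ∀ i j → ¬ i ≡ j → τ i ∩ τ j ≡ ⊥
    τ-disjoint i j i≢j = disjoint⁺ λ {v} v∈τi v∈τj →
      let
        -- The shared vertex `v` is taken at `i` and `j`; elsewhere any vertex of the missing edge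
        -- will do, one existing because `k` is nonzero.
        choice : ∀ l → ∃[ x ] x ∈ U l × (l ≡ i ⊎ l ≡ j → x ≡ v)
        choice l = case l ≟ i of λ
          { (yes refl) → v , proj₁ (proj₂ (pick i)) v∈τi , λ _ → refl
          ; (no l≢i) → case l ≟ j of λ
            { (yes refl) → v , proj₁ (proj₂ (pick j)) v∈τj , λ _ → refl
            ; (no l≢j) → let x , x∈ = τ-nonempty l in
                x , proj₁ (proj₂ (pick l)) x∈ , λ { (inj₁ eq) → contradiction eq l≢i ; (inj₂ eq) → contradiction eq l≢j } } }
        t = tabulate (proj₁ ∘ choice)
        t≡ l = Vec.lookup∘tabulate (proj₁ ∘ choice) l
        distinct = proj₂ (isGood t λ l → subst (_∈ U l) (sym (t≡ l)) (proj₁ (proj₂ (choice l))))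
        value l h = trans (t≡ l) (proj₂ (proj₂ (choice l)) h)
      in i≢j (distinct i j (trans (value i (inj₁ refl)) (sym (value j (inj₂ refl)))))

  -- Powers against binomial coefficients.

  C-absorption : ∀ n m → suc m * (suc n C suc m) ≡ suc n * (n C m)
  C-absorption n zero = trans (*-identityˡ (suc n C 1)) (trans (nC1≡n (suc n)) (sym (*-identityʳ (suc n))))
  C-absorption zero (suc m) = trans
    (trans (cong (suc (suc m) *_) (k>n⇒nCk≡0 {1} {suc (suc m)} (s≤s (s≤s z≤n)))) (*-zeroʳ (suc (suc m))))
    (cong (1 *_) (sym (k>n⇒nCk≡0 {0} {suc m} (s≤s z≤n))))
  C-absorption (suc n) (suc m) = begin
    suc (suc m) * (suc (suc n) C suc (suc m))            ≡⟨ cong (suc (suc m) *_) (sym (nCk+nC[k+1]≡[n+1]C[k+1] (suc n) (suc m))) ⟩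
    suc (suc m) * (c + suc n C suc (suc m))              ≡⟨ expand (suc m) c _ ⟩
    c + (suc m * c + suc (suc m) * (suc n C suc (suc m)))
      ≡⟨ cong (c +_) (cong₂ _+_ (C-absorption n m) (C-absorption n (suc m))) ⟩
    c + (suc n * (n C m) + suc n * (n C suc m))          ≡⟨ cong (c +_) (sym (*-distribˡ-+ (suc n) (n C m) _)) ⟩
    c + suc n * (n C m + n C suc m)                      ≡⟨ cong (λ z → c + suc n * z) (nCk+nC[k+1]≡[n+1]C[k+1] n m) ⟩
    suc (suc n) * c                                      ∎
    where
    open ≡-Reasoning
    c = suc n C suc m
    expand : ∀ m c x → suc m * (c + x) ≡ c + (m * c + suc m * x)
    expand = solve-∀

  -- Equals 2^(m(m-1)/2) m!. Each step pays `2 ^ m` for bounding n+1 by 2n and `suc m` for the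
  -- absorption identity.
  binomialFactor : ℕ → ℕ
  binomialFactor zero    = 1
  binomialFactor (suc m) = 2 ^ m * binomialFactor m * suc m

  ^≤binomialFactor*C : ∀ {n} m → m ≤ n → n ^ m ≤ binomialFactor m * (n C m)
  ^≤binomialFactor*C {n}     zero    _         = s≤s z≤n
  ^≤binomialFactor*C {suc n} (suc m) (s≤s m≤n) = begin
    suc n * suc n ^ m                         ≤⟨ *-monoʳ-≤ (suc n) (double m≤n) ⟩
    suc n * (2 * n) ^ m                       ≡⟨ cong (suc n *_) (^-distribʳ-* 2 n m) ⟩
    suc n * (2 ^ m * n ^ m)                   ≤⟨ *-monoʳ-≤ (suc n) (*-monoʳ-≤ (2 ^ m) (^≤binomialFactor*C m m≤n)) ⟩
    suc n * (2 ^ m * (K * (n C m)))           ≡⟨ r₁ (suc n) (2 ^ m) K (n C m) ⟩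
    2 ^ m * K * (suc n * (n C m))             ≡⟨ cong (2 ^ m * K *_) (sym (C-absorption n m)) ⟩
    2 ^ m * K * (suc m * (suc n C suc m))     ≡⟨ sym (*-assoc (2 ^ m * K) (suc m) _) ⟩
    2 ^ m * K * suc m * (suc n C suc m)       ∎
    where
    open ≤-Reasoning
    K = binomialFactor m
    r₁ : ∀ a b c d → a * (b * (c * d)) ≡ b * c * (a * d)
    r₁ = solve-∀
    double : ∀ {m n} → m ≤ n → suc n ^ m ≤ (2 * n) ^ m
    double {zero}              _ = s≤s z≤n
    double {suc m} {n@(suc _)} _ = ^-monoˡ-≤ (suc m) (+-mono-≤ (s≤s (z≤n)) (≤-reflexive (sym (+-identityʳ n))))

  -- Translation between rational and integer inequalities.

  toℚᵘ-toℚ : ∀ a → toℚᵘ (toℚ a) ℚᵘ.≃ ℚᵘ.mkℚᵘ (ℤ.+ a) 0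
  toℚᵘ-toℚ a = ℚ.toℚᵘ-fromℚᵘ (ℚᵘ.mkℚᵘ (ℤ.+ a) 0)

  -- The numerator of a positive rational is at least 1, so `α` may be replaced by the reciprocal of
  -- its denominator.
  clearDenominator : ∀ α a b → 0ℚ ℚ.< α → α ℚ.* toℚ a ℚ.≤ toℚ b → a ≤ ℚ.↧ₙ α * b
  clearDenominator (mkℚ (ℤ.+ zero) d _) a b (*<* (ℤ.+<+ ())) _
  clearDenominator α@(mkℚ (ℤ.+ suc p) d _) a b (*<* _) α*a≤b = begin
    a                     ≤⟨ m≤m+n a (p * a) ⟩
    suc p * a             ≡⟨ sym (*-identityʳ (suc p * a)) ⟩
    suc p * a * 1         ≤⟨ ℤ.drop‿+≤+ (subst₂ ℤ._≤_ eq₁ eq₂ (ℚᵘ.drop-*≤* unnormalised)) ⟩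
    b * (suc d * 1)       ≡⟨ trans (cong (b *_) (*-identityʳ (suc d))) (*-comm b (suc d)) ⟩
    suc d * b             ∎
    where
    open ≤-Reasoning
    unnormalised : toℚᵘ α ℚᵘ.* ℚᵘ.mkℚᵘ (ℤ.+ a) 0 ℚᵘ.≤ ℚᵘ.mkℚᵘ (ℤ.+ b) 0
    unnormalised = ℚᵘ.≤-respˡ-≃ (ℚᵘ.≃-trans (ℚ.toℚᵘ-homo-* α (toℚ a)) (ℚᵘ.*-congˡ {toℚᵘ α} (toℚᵘ-toℚ a)))
                  (ℚᵘ.≤-respʳ-≃ (toℚᵘ-toℚ b) (ℚ.toℚᵘ-mono-≤ α*a≤b))
    eq₁ : (ℤ.+ suc p ℤ.* ℤ.+ a) ℤ.* ℤ.+ 1 ≡ ℤ.+ (suc p * a * 1)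
    eq₁ = trans (cong (ℤ._* ℤ.+ 1) (sym (ℤ.pos-* (suc p) a))) (sym (ℤ.pos-* (suc p * a) 1))
    eq₂ : ℤ.+ b ℤ.* ℤ.+ (suc d * 1) ≡ ℤ.+ (b * (suc d * 1))
    eq₂ = sym (ℤ.pos-* b (suc d * 1))

  reciprocal-*-≤ : ∀ b n s → n ≤ suc b * s → (ℤ.+ 1 ℚ./ suc b) ℚ.* toℚ n ℚ.≤ toℚ s
  reciprocal-*-≤ b n s n≤bs = ℚ.toℚᵘ-cancel-≤ (begin
    toℚᵘ (β ℚ.* toℚ n)                     ≃⟨ ℚ.toℚᵘ-homo-* β (toℚ n) ⟩
    toℚᵘ β ℚᵘ.* toℚᵘ (toℚ n)               ≃⟨ ℚᵘ.*-cong (ℚ.toℚᵘ-fromℚᵘ (ℚᵘ.mkℚᵘ (ℤ.+ 1) b)) (toℚᵘ-toℚ n) ⟩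
    ℚᵘ.mkℚᵘ (ℤ.+ 1) b ℚᵘ.* ℚᵘ.mkℚᵘ (ℤ.+ n) 0   ≤⟨ ℚᵘ.*≤* (subst₂ ℤ._≤_ eq₁ eq₂ (ℤ.+≤+ n≤bs)) ⟩
    ℚᵘ.mkℚᵘ (ℤ.+ s) 0                        ≃⟨ ℚᵘ.≃-sym (toℚᵘ-toℚ s) ⟩
    toℚᵘ (toℚ s)                           ∎)
    where
    open ℚᵘ.≤-Reasoning
    β = ℤ.+ 1 ℚ./ suc b
    eq₁ : ℤ.+ n ≡ (ℤ.+ 1 ℤ.* ℤ.+ n) ℤ.* ℤ.+ 1
    eq₁ = sym (trans (ℤ.*-identityʳ _) (ℤ.*-identityˡ (ℤ.+ n)))
    eq₂ : ℤ.+ (suc b * s) ≡ ℤ.+ s ℤ.* ℤ.+ (suc b * 1)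
    eq₂ = trans (cong ℤ.+_ (trans (*-comm (suc b) s) (cong (s *_) (sym (*-identityʳ (suc b)))))) (ℤ.pos-* s (suc b * 1))

  0<reciprocal : ∀ b → 0ℚ ℚ.< ℤ.+ 1 ℚ./ suc b
  0<reciprocal b = ℚ.positive⁻¹ (ℤ.+ 1 ℚ./ suc b) {{ℚ.normalize-pos 1 (suc b)}}

  -- Choice of constants and conclusion.

  -- The theorem in natural numbers, with density 1/d and β = 1/(b+1). All subsets are searched for
  -- a large enough clique; finding none forces richness, hence a complete tuple.
  largeClique : ∀ k m d → 2 ≤ k → k ≤ m → ∃[ b ] (∀ n (H : Hypergraph k n) →
    n C m ≤ d * cliqueCount m H → ¬ HasCompleteTuple m H → ∃[ S ] IsClique H S × n ≤ suc b * ∣ S ∣)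
  largeClique k m d 2≤k k≤m = b , find-clique
    where
    c = 2 * k * m
    q = binomialFactor m * d
    D = scale m ((2 * c) ^ m) m q
    -- Each summand serves one bound: `2 * D` excludes cliques on n/(2D) vertices, `c * D` makes `n`
    -- large enough for richness, and `m` gives `m ≤ n` for the binomial estimate.
    b = 2 * D + (c * D + m)
    0<k : 0 < k
    0<k = ≤-trans (s≤s z≤n) 2≤k
    instance
      k≢0 : NonZero k
      k≢0 = >-nonZero 0<k
      c≢0 : NonZero c
      c≢0 = m*n≢0 (2 * k) m {{m*n≢0 2 k}} {{>-nonZero (≤-trans 0<k k≤m)}}
    find-clique : ∀ n (H : Hypergraph k n) → n C m ≤ d * cliqueCount m H → ¬ HasCompleteTuple m H →
                  ∃[ S ] IsClique H S × n ≤ suc b * ∣ S ∣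
    find-clique zero H _ _ = ⊥ , small-clique H ⊥ 0<k , z≤n
    find-clique n@(suc _) H dense noTuple
      with Sub.anySubset? (λ S → (isCliqueᵇ H S Bool.≟ true) ×-dec (n ≤? suc b * ∣ S ∣))
    ... | yes found = found
    ... | no  none  = contradiction (Rich⇒completeTuple H ((2 * c) ^ m) q
        (noBigClique⇒Rich k m H D noTuple (≤-trans (≤-trans (m≤m+n (c * D) m) (m≤n+m _ (2 * D))) b≤n) noBig)
        denseTuples) noTuple
      where
      open ≤-Reasoning
      b≤n : b ≤ n
      -- If n ≤ b, a single vertex is already a large enough clique; it is a clique because `2 ≤ k`.
      b≤n with suc b ≤? n
      ... | yes b<n = <⇒≤ b<n
      ... | no  b≮n = contradiction
            (⁅ zero ⁆ , small-clique H ⁅ zero ⁆ (subst (_< k) (sym (Sub.∣⁅x⁆∣≡1 {n} zero)) 2≤k) ,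
            subst (λ z → n ≤ suc b * z) (sym (Sub.∣⁅x⁆∣≡1 {n} zero))
              (≤-trans (<⇒≤ (≰⇒> b≮n)) (≤-reflexive (sym (*-identityʳ (suc b)))))) none
      noBig : ∀ S → n ≤ 2 * D * ∣ S ∣ → isCliqueᵇ H S ≡ false
      noBig S big with isCliqueᵇ H S in eq
      ... | false = refl
      ... | true  = contradiction (S , eq , ≤-trans big (*-monoˡ-≤ ∣ S ∣ (m≤n⇒m≤1+n (m≤m+n (2 * D) _)))) none
      denseTuples : n ^ m ≤ q * count (isCliqueTupleᵇ H) (finTuples n m)
      denseTuples = begin
        n ^ m                                          ≤⟨ ^≤binomialFactor*C m (≤-trans (≤-trans (m≤n+m m (c * D)) (m≤n+m _ (2 * D))) b≤n) ⟩
        binomialFactor m * (n C m)                     ≤⟨ *-monoʳ-≤ (binomialFactor m) dense ⟩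
        binomialFactor m * (d * cliqueCount m H)       ≤⟨ *-monoʳ-≤ (binomialFactor m) (*-monoʳ-≤ d (cliqueCount≤ m H)) ⟩
        binomialFactor m * (d * count (isCliqueTupleᵇ H) (finTuples n m)) ≡⟨ sym (*-assoc (binomialFactor m) d _) ⟩
        q * count (isCliqueTupleᵇ H) (finTuples n m)   ∎

open Blowup using (largeClique; clearDenominator; reciprocal-*-≤; 0<reciprocal)
open import Data.Rational using (_*_; _<_) renaming (_≤_ to _≤ℚ_)

theorem2 : (k m : ℕ) → 2 ≤ k → k ≤ m → (α : ℚ) → 0ℚ < α → α < 1ℚ →
    Σ ℚ (λ β → (0ℚ < β) ×
    ((n : ℕ) (H : Hypergraph k n) →
    α * toℚ (n C m) ≤ℚ toℚ (cliqueCount m H) →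
    ¬ HasCompleteTuple m H →
    Σ (Subset n) (λ S → IsClique H S × (β * toℚ n ≤ℚ toℚ ∣ S ∣))))
theorem2 k m 2≤k k≤m α 0<α _ =
  -- The denominator of `α` plays the part of `d`, so `b` depends only on `k`, `m` and `α`.
  let b , find-clique = largeClique k m (ℚ.↧ₙ α) 2≤k k≤m in
  ℤ.+ 1 ℚ./ suc b , 0<reciprocal b , λ n H dense noTuple →
    let S , clique , n≤ = find-clique n H (clearDenominator α (n C m) (cliqueCount m H) 0<α dense) noTuple in
    S , clique , reciprocal-*-≤ b n ∣ S ∣ n≤
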